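{- The labelled calculus $\mathcal{T}\mathbf{R}^{\mathbf{T}}$ is sound with respect to rational models: for every set $\Gamma$ of labelled formulas, if there is a closed tableau for $\Gamma$ in $\mathcal{T}\mathbf{R}^{\mathbf{T}}$, then $\Gamma$ is unsatisfiable.
   Context: **Language.** Propositional formulas ($A,B,\dots$) are built from a set $\mathit{ATM}$ of propositional variables with $\neg,\wedge,\vee,\rightarrow$. $\mathcal{L}$ consists of the boolean combinations of propositional formulas and conditionals $A\mathrel{|\!\sim}B$ ($A,B$ propositional); $\mathcal{L}_R$ extends $\mathcal{L}$ by formulas $\Box\neg A$ ($A$ propositional). $F,G$ denote arbitrary formulas. Let $\mathcal{A}$ be a denumerable alphabet of labels. Labelled formulas are world formulas $x:F$ ($x\in\mathcal{A}$, $F\in\mathcal{L}_R$) and relation formulas $x<y$ ($x,y\in\mathcal{A}$). **Semantics.** A rational model is $\mathcal{M}=\langle\mathcal{W},<,V\rangle$ with $\mathcal{W}\neq\emptyset$ a set of worlds, $<$ an irreflexive, transitive and modular relation on $\mathcal{W}$ (modular: for all $w,w_1,w_2$, if $w_1<w_2$ then $w_1<w$ or $w<w_2$), $V:\mathcal{W}\to\mathrm{pow}(\mathit{ATM})$. Boolean combinations are evaluated classically at worlds. $Min_<(A)=\{w\mid\mathcal{M},w\models A$ and for all $w'<w$, $\mathcal{M},w'\not\models A\}$. $\mathcal{M},w\models A\mathrel{|\!\sim}B$ iff $\mathcal{M},w'\models B$ for all $w'\in Min_<(A)$. $\mathcal{M},w\models\Box\neg A$ iff $\mathcal{M},w'\models\neg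 A$ for all $w'<w$. Smoothness (part of the definition): for every propositional $A$, if $\mathcal{M},w\models A$ then $w\in Min_<(A)$ or there is $w'\in Min_<(A)$ with $w'<w$. For a map $I:\mathcal{A}\to\mathcal{W}$: $\mathcal{M}\models_I x:F$ iff $\mathcal{M},I(x)\models F$; $\mathcal{M}\models_I x<y$ iff $I(x)<I(y)$. A set $\Gamma$ of labelled formulas is satisfiable if for some rational $\mathcal{M}$ and some $I$, $\mathcal{M}\models_I\alpha$ for all $\alpha\in\Gamma$; otherwise unsatisfiable. **Calculus $\mathcal{T}\mathbf{R}^{\mathbf{T}}$.** Nodes are sets of labelled formulas; $\Gamma,\alpha$ means $\Gamma\cup\{\alpha\}$. Each positive conditional carries a list $L$ of labels already used, written $u:A\mathrel{|\!\sim}B^{L}$ (initially empty; it has no semantic meaning). Let $\Gamma^M_{x\to y}=\{y:\neg A,\ y:\Box\neg A\mid x:\Box\neg A\in\Gamma\}$. Rules (premise $\leadsto$ conclusions, separated by $\mid$): - axioms: $\Gamma,x:P,x:\neg P$ with $P\in\mathit{ATM}$; and $\Gamma,x<y,y<x$; - boolean rules: $\Gamma,x:\neg\neg F\leadsto\Gamma,x:F$; $\ \Gamma,x:F\wedge G\leadsto\Gamma,x:F,x:G$; $\ \Gamma,x:\neg(F\wedge G)\leadsto\Gamma,x:\neg F\mid\Gamma,x:\neg G$; $\ \Gamma,x:F\vee G\leadsto\Gamma,x:F\mid\Gamma,x:G$; $\ \Gamma,x:\neg(F\vee G)\leadsto\Gamma,x:\neg F,x:\neg G$; $\ \Gamma,x:F\rightarrow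 G\leadsto\Gamma,x:\neg F\mid\Gamma,x:G$; $\ \Gamma,x:\neg(F\rightarrow G)\leadsto\Gamma,x:F,x:\neg G$; - $(|\!\sim^+)$, for a label $x$ occurring in the premise with $x\notin L$: $\Gamma,u:A\mathrel{|\!\sim}B^{L}\leadsto\Gamma,x:\neg A,u:A\mathrel{|\!\sim}B^{L,x}\mid\Gamma,x:\neg\Box\neg A,u:A\mathrel{|\!\sim}B^{L,x}\mid\Gamma,x:B,u:A\mathrel{|\!\sim}B^{L,x}$; - $(|\!\sim^-)$, $x$ a new label: $\Gamma,u:\neg(A\mathrel{|\!\sim}B)\leadsto\Gamma,x:A,x:\Box\neg A,x:\neg B$; - $(\Box^-)$, $y$ a new label: $\Gamma,x:\neg\Box\neg A\leadsto\Gamma,y<x,\Gamma^M_{x\to y},y:A,y:\Box\neg A$; - $(<)$, for a label $z$ occurring in the premise such that neither $x<z$ nor $z<y$ belongs to the premise: $\Gamma,x<y\leadsto\Gamma,x<y,z<y,\Gamma^M_{y\to z}\mid\Gamma,x<y,x<z,\Gamma^M_{z\to x}$. A tableau for $\Gamma$ is a tree with root $\Gamma$ in which the children of each non-leaf node are the conclusions of a rule applied to that node. A branch is closed if one of its nodes is an axiom; a tableau is closed if all its branches are closed. -}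

module Defs where

open import Data.List.Base using (List; []; _∷_; _∷ʳ_; head; drop)
open import Data.List.Membership.Propositional using () renaming (_∉_ to _∉ˡ_)
open import Data.Maybe using (Maybe; just; nothing; Is-just)
open import Data.Maybe.Relation.Unary.Any using (Any)
open import Data.Nat.Base using (ℕ)
open import Data.Product.Base using (_×_; _,_; ∃; ∃-syntax)
open import Data.Sum.Base using (_⊎_)
open import Level using (0ℓ)
open import Relation.Binary.Core using (Rel)
open import Relation.Binary.Definitions using (Irreflexive; Transitive)
open import Relation.Binary.PropositionalEquality.Core using (_≡_)
open import Relation.Nullary.Negation.Core using (¬_)
open import Relation.Unary using (Pred; _∈_; _∉_; _∪_; ｛_｝; _≐_)

infix  9 ~_
infixr 8 _∧_
infixr 7 _∨_
infixr 6 _⇒_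

data Boolean (X : Set) : Set where
  atom        : X → Boolean X
  ~_          : Boolean X → Boolean X
  _∧_ _∨_ _⇒_ : Boolean X → Boolean X → Boolean X

map : ∀ {X Y : Set} → (X → Y) → Boolean X → Boolean Y
map f (atom x) = atom (f x)
map f (~ F)    = ~ map f F
map f (F ∧ G)  = map f F ∧ map f G
map f (F ∨ G)  = map f F ∨ map f G
map f (F ⇒ G)  = map f F ⇒ map f G

-- The metatheory of the calculus is classical.  Throughout, a disjunction or an
-- existential that is asserted (a clause of truth, a law of models, the closure
-- of a branch) is read classically, as ¬ ¬ (… ⊎ …) or ¬ ¬ (∃ …).  Under excluded
-- middle this is the literal reading.  Every ⟦ v ⟧ F is ¬¬-stable, with no
-- decidability assumption on the valuation.
⟦_⟧ : ∀ {X : Set} → (X → Set) → Boolean X → Set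
⟦ v ⟧ (atom x) = ¬ ¬ v x
⟦ v ⟧ (~ F)    = ¬ ⟦ v ⟧ F
⟦ v ⟧ (F ∧ G)  = ⟦ v ⟧ F × ⟦ v ⟧ G
⟦ v ⟧ (F ∨ G)  = ¬ ¬ (⟦ v ⟧ F ⊎ ⟦ v ⟧ G)
⟦ v ⟧ (F ⇒ G)  = ⟦ v ⟧ F → ⟦ v ⟧ G

Label : Set
Label = ℕ

module Logic (ATM : Set) where

  Propositional : Set
  Propositional = Boolean ATM

  infix 10 _|~_ □¬_

  data Basic : Set where
    var  : ATM → Basic
    _|~_ : Propositional → Propositional → Basic
    □¬_  : Propositional → Basic

  -- ℒ_R: boolean combinations of propositional formulas, conditionals and
  -- boxed negations.
  Formula : Set
  Formula = Boolean Basic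

  ⌜_⌝ : Propositional → Formula
  ⌜_⌝ = map var

  infix 5 _∶_ _≺_

  data LabelledFormula : Set where
    _∶_ : Label → Formula → LabelledFormula
    _≺_ : Label → Label → LabelledFormula

  module Preferential {W : Set} (_<_ : Rel W 0ℓ) (V : W → Pred ATM 0ℓ) where

    infix 4 _⊨ᵖ_ _⊨_

    _⊨ᵖ_ : W → Propositional → Set
    w ⊨ᵖ A = ⟦ V w ⟧ A

    Min : Propositional → Pred W 0ℓ
    Min A w = w ⊨ᵖ A × (∀ w′ → w′ < w → ¬ (w′ ⊨ᵖ A))

    basic : W → Basic → Set
    basic w (var P)  = V w P
    basic w (A |~ B) = ∀ w′ → w′ ∈ Min A → w′ ⊨ᵖ B
    basic w (□¬ A)   = ∀ w′ → w′ < w → w′ ⊨ᵖ ~ A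

    -- On ⌜ A ⌝ this agrees with w ⊨ᵖ A.
    _⊨_ : W → Formula → Set
    w ⊨ F = ⟦ basic w ⟧ F

  record RationalModel : Set₁ where
    field
      W   : Set
      _<_ : Rel W 0ℓ
      V   : W → Pred ATM 0ℓ

    open Preferential _<_ V public

    field
      nonempty    : ¬ ¬ W
      irreflexive : Irreflexive _≡_ _<_
      transitive  : Transitive _<_
      modular     : ∀ w w₁ w₂ → w₁ < w₂ → ¬ ¬ (w₁ < w ⊎ w < w₂)
      smooth      : ∀ A w → w ⊨ᵖ A →
                    ¬ ¬ (w ∈ Min A ⊎ (∃[ w′ ] w′ ∈ Min A × w′ < w))

  module _ (M : RationalModel) where
    open RationalModel M

    Holds : (Label → W) → LabelledFormula → Set
    Holds I (x ∶ F) = I x ⊨ F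
    Holds I (x ≺ y) = I x < I y

  Satisfiable : Pred LabelledFormula 0ℓ → Set₁
  Satisfiable Γ = ∃[ M ] ∃[ I ] (∀ {α} → α ∈ Γ → Holds M I α)

  Unsatisfiable : Pred LabelledFormula 0ℓ → Set₁
  Unsatisfiable Γ = ¬ Satisfiable Γ

  infix 4 _^_

  -- A labelled formula with its list of used labels.  Only positive conditionals
  -- have a proper list: on every other formula the list is empty in the root and
  -- no rule changes it.
  data Annotated : Set where
    _^_ : LabelledFormula → List Label → Annotated

  Node : Set₁
  Node = Pred Annotated 0ℓ

  infixl 3 _▸ᵃ_ _▸_

  _▸ᵃ_ : Node → Annotated → Node
  Γ ▸ᵃ φ = Γ ∪ ｛ φ ｝

  _▸_ : Node → LabelledFormula → Node
  Γ ▸ α = Γ ▸ᵃ (α ^ [])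

  data Initial (Γ : Pred LabelledFormula 0ℓ) : Node where
    initial : ∀ {α} → α ∈ Γ → Initial Γ (α ^ [])

  data Mentions (x : Label) : LabelledFormula → Set where
    world : ∀ {F} → Mentions x (x ∶ F)
    left  : ∀ {y} → Mentions x (x ≺ y)
    right : ∀ {y} → Mentions x (y ≺ x)

  -- The list L is bookkeeping: labels in it do not count as occurrences.
  Occurs : Label → Node → Set
  Occurs x Γ = ∃[ α ] ∃[ L ] (α ^ L) ∈ Γ × Mentions x α

  New : Label → Node → Set
  New x Γ = ¬ Occurs x Γ

  data Transfer (Γ : Node) (x y : Label) : Node where
    negation : ∀ {A} → (x ∶ atom (□¬ A) ^ []) ∈ Γ → Transfer Γ x y (y ∶ ~ ⌜ A ⌝ ^ [])
    box      : ∀ {A} → (x ∶ atom (□¬ A) ^ []) ∈ Γ → Transfer Γ x y (y ∶ atom (□¬ A) ^ [])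

  data Axiom (Γ : Node) : Set where
    clash : ∀ x P → (x ∶ atom (var P) ^ []) ∈ Γ → (x ∶ ~ atom (var P) ^ []) ∈ Γ → Axiom Γ
    cycle : ∀ x y → (x ≺ y ^ []) ∈ Γ → (y ≺ x ^ []) ∈ Γ → Axiom Γ

  infix 2 _,_⤳_ _⟶_

  -- Γ , φ ⤳ Δs: the premise Γ ∪ { φ } with principal formula φ has conclusions Δs.
  -- As Γ ∪ { φ } is a union of sets, Γ may or may not itself contain φ.
  data _,_⤳_ (Γ : Node) : Annotated → List Node → Set₁ where

    ¬¬ᵣ : ∀ {x F} →
          Γ , (x ∶ ~ ~ F ^ []) ⤳ (Γ ▸ x ∶ F) ∷ []

    ∧⁺  : ∀ {x F G} →
          Γ , (x ∶ F ∧ G ^ []) ⤳ (Γ ▸ x ∶ F ▸ x ∶ G) ∷ []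

    ∧⁻  : ∀ {x F G} →
          Γ , (x ∶ ~ (F ∧ G) ^ []) ⤳ (Γ ▸ x ∶ ~ F) ∷ (Γ ▸ x ∶ ~ G) ∷ []

    ∨⁺  : ∀ {x F G} →
          Γ , (x ∶ F ∨ G ^ []) ⤳ (Γ ▸ x ∶ F) ∷ (Γ ▸ x ∶ G) ∷ []

    ∨⁻  : ∀ {x F G} →
          Γ , (x ∶ ~ (F ∨ G) ^ []) ⤳ (Γ ▸ x ∶ ~ F ▸ x ∶ ~ G) ∷ []

    ⇒⁺  : ∀ {x F G} →
          Γ , (x ∶ F ⇒ G ^ []) ⤳ (Γ ▸ x ∶ ~ F) ∷ (Γ ▸ x ∶ G) ∷ []

    ⇒⁻  : ∀ {x F G} →
          Γ , (x ∶ ~ (F ⇒ G) ^ []) ⤳ (Γ ▸ x ∶ F ▸ x ∶ ~ G) ∷ []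

    |~⁺ : ∀ {u A B L} x →
          Occurs x (Γ ▸ᵃ (u ∶ atom (A |~ B) ^ L)) →
          x ∉ˡ L →
          Γ , (u ∶ atom (A |~ B) ^ L) ⤳
            (Γ ▸ x ∶ ~ ⌜ A ⌝         ▸ᵃ (u ∶ atom (A |~ B) ^ L ∷ʳ x)) ∷
            (Γ ▸ x ∶ ~ atom (□¬ A)   ▸ᵃ (u ∶ atom (A |~ B) ^ L ∷ʳ x)) ∷
            (Γ ▸ x ∶ ⌜ B ⌝           ▸ᵃ (u ∶ atom (A |~ B) ^ L ∷ʳ x)) ∷ []

    |~⁻ : ∀ {u A B} x →
          New x (Γ ▸ u ∶ ~ atom (A |~ B)) →
          Γ , (u ∶ ~ atom (A |~ B) ^ []) ⤳
            (Γ ▸ x ∶ ⌜ A ⌝ ▸ x ∶ atom (□¬ A) ▸ x ∶ ~ ⌜ B ⌝) ∷ []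

    □⁻  : ∀ {x A} y →
          New y (Γ ▸ x ∶ ~ atom (□¬ A)) →
          Γ , (x ∶ ~ atom (□¬ A) ^ []) ⤳
            (((Γ ▸ y ≺ x) ∪ Transfer Γ x y) ▸ y ∶ ⌜ A ⌝ ▸ y ∶ atom (□¬ A)) ∷ []

    <ᵣ  : ∀ {x y} z →
          Occurs z (Γ ▸ x ≺ y) →
          (x ≺ z ^ []) ∉ (Γ ▸ x ≺ y) →
          (z ≺ y ^ []) ∉ (Γ ▸ x ≺ y) →
          Γ , (x ≺ y ^ []) ⤳
            ((Γ ▸ x ≺ y ▸ z ≺ y) ∪ Transfer Γ y z) ∷
            ((Γ ▸ x ≺ y ▸ x ≺ z) ∪ Transfer Γ z x) ∷ []

  data _⟶_ (N : Node) : List Node → Set₁ where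
    apply : ∀ {Γ φ Δs} → N ≐ (Γ ▸ᵃ φ) → Γ , φ ⤳ Δs → N ⟶ Δs

  -- i ∷ p addresses the i-th child of the tree node addressed by p.
  Address : Set
  Address = List ℕ

  data Local : Maybe Node → (ℕ → Maybe Node) → Set₁ where
    absent   : ∀ {c} → (∀ i → c i ≡ nothing) → Local nothing c
    leaf     : ∀ {N c} → (∀ i → c i ≡ nothing) → Local (just N) c
    expanded : ∀ {N c Δs} → N ⟶ Δs → (∀ i → c i ≡ head (drop i Δs)) → Local (just N) c

  -- A possibly infinite tree, as a partial function from addresses to nodes.
  record Tableau (N : Node) : Set₁ where
    field
      at    : Address → Maybe Node
      root  : at [] ≡ just N
      local : ∀ p → Local (at p) (λ i → at (i ∷ p))

  -- A maximal path from the root, finite or infinite.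
  record Branch {N : Node} (T : Tableau N) : Set₁ where
    open Tableau T
    field
      On      : Pred Address 0ℓ
      present : ∀ {p} → p ∈ On → Is-just (at p)
      start   : [] ∈ On
      parent  : ∀ {i p} → (i ∷ p) ∈ On → p ∈ On
      linear  : ∀ {i j p} → (i ∷ p) ∈ On → (j ∷ p) ∈ On → i ≡ j
      maximal : ∀ {i p} → p ∈ On → Is-just (at (i ∷ p)) → ¬ ¬ (∃[ j ] (j ∷ p) ∈ On)

  ClosedBranch : {N : Node} {T : Tableau N} → Branch T → Set₁
  ClosedBranch {T = T} B = ¬ ¬ (∃[ p ] p ∈ Branch.On B × Any Axiom (Tableau.at T p))

  ClosedTableau : {N : Node} → Tableau N → Set₁
  ClosedTableau T = ∀ (B : Branch T) → ClosedBranch B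

{-# OPTIONS --safe #-}
module Submission where

-- Suppose the root is satisfied in a rational model M.  Call a node satisfied
-- when some interpretation of the labels in M makes all its formulas true; M is
-- fixed once and for all, only the interpretation varies from node to node.
--
-- Every rule preserves satisfaction: if its premise is satisfied then,
-- classically, so is one of its conclusions (rule-sound).  The boolean cases are
-- truth tables.  The two rules that introduce a new label need a minimal world:
-- a false conditional provides one outright (counterexample), a false box through
-- smoothness (diamond-minimal).  The interpretation is then changed at the new
-- label only, which no formula of the premise can notice (reinterpret).  The
-- formulas in Transfer are true because boxes are inherited by smaller worlds
-- (transfer-sound), and the branching of the rule for < is modularity.  No
-- satisfied node is an axiom (axiom-unsatisfied).
--
-- Hence a satisfied root starts a maximal path of satisfied nodes, and that
-- path is an open branch.  The tree may be infinite, so the path has to be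
-- given as one predicate on addresses without choosing a satisfied child at each
-- step.  This is done by always moving to the first satisfied child: being first
-- is definable and determines the child uniquely, and it exists up to double
-- negation by the least number principle (¬¬-least), which is all that
-- maximality of a branch asks for.

open import Level using (Level; 0ℓ)
open import Data.Empty using (⊥)
open import Data.List.Base using ([]; _∷_; head; drop)
open import Data.List.Relation.Unary.Any using (here; there) renaming (Any to Anyˡ)
open import Data.Maybe using (Maybe; just; maybe′; Is-just)
import Data.Maybe.Relation.Unary.Any as Maybe
open import Data.Nat.Base using (ℕ; _<_)
open import Data.Nat.Induction using (<-rec)
open import Data.Nat.Properties using (_≟_; <-cmp)
open import Data.Product.Base using (_×_; _,_; ∃-syntax; proj₁; proj₂)
open import Data.Sum.Base using (_⊎_; inj₁; inj₂; [_,_]′)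
open import Data.Unit.Base using (⊤; tt)
open import Function.Base using (_∘_; _$_)
open import Relation.Binary.Definitions using (tri<; tri≈; tri>)
open import Relation.Binary.PropositionalEquality
  using (_≡_; _≢_; refl; sym; cong; cong₂; subst; subst₂)
open import Relation.Nullary.Decidable using (yes; no)
open import Relation.Nullary.Negation using (¬_; contradiction)
open import Relation.Unary using (Pred; _∈_; _∪_)
open import Defs

-- Classical reasoning under double negation

private variable
  a b : Level

infixl 1 _>>=_

_>>=_ : {A : Set a} {B : Set b} → ¬ ¬ A → (A → ¬ ¬ B) → ¬ ¬ B
(m >>= f) k = m λ x → f x k

return : {A : Set a} → A → ¬ ¬ A
return x k = k x

-- The numbers that are smallest with P; there is at most one.
Least : Pred ℕ 0ℓ → Pred ℕ 0ℓ
Least P i = P i × (∀ j → j < i → ¬ P j)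

-- The classical least number principle, for a predicate that need not be decidable.
¬¬-least : (P : Pred ℕ 0ℓ) → ∀ i → P i → ¬ ¬ (∃[ j ] Least P j)
¬¬-least P = <-rec _ λ i smaller Pi none →
  none (i , Pi , λ j j<i Pj → smaller j<i Pj none)

least-unique : ∀ {P i j} → Least P i → Least P j → i ≡ j
least-unique {i = i} {j} (Pi , mini) (Pj , minj) with <-cmp i j
... | tri< i<j _ _ = contradiction Pi (minj i i<j)
... | tri≈ _ i≡j _ = i≡j
... | tri> _ _ j<i = contradiction Pj (mini j j<i)

-- Truth of boolean combinations

⟦⟧-stable : ∀ {X v} (F : Boolean X) → ¬ ¬ ⟦ v ⟧ F → ⟦ v ⟧ F
⟦⟧-stable (atom x) h k = h (_$ k)
⟦⟧-stable (~ F)    h k = h (_$ k)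
⟦⟧-stable (F ∧ G)  h   = ⟦⟧-stable F (λ k → h (k ∘ proj₁)) , ⟦⟧-stable G (λ k → h (k ∘ proj₂))
⟦⟧-stable (F ∨ G)  h k = h (_$ k)
⟦⟧-stable (F ⇒ G)  h t = ⟦⟧-stable G (λ k → h (λ f → k (f t)))

-- As an equality of types, this identifies truth of ⌜ A ⌝ with truth of A.
⟦⟧-map : ∀ {X Y : Set} {v : Y → Set} {f : X → Y} (A : Boolean X) →
         ⟦ v ⟧ (map f A) ≡ ⟦ v ∘ f ⟧ A
⟦⟧-map (atom x) = refl
⟦⟧-map (~ A)    = cong ¬_ (⟦⟧-map A)
⟦⟧-map (A ∧ B)  = cong₂ _×_ (⟦⟧-map A) (⟦⟧-map B)
⟦⟧-map (A ∨ B)  = cong₂ (λ S T → ¬ ¬ (S ⊎ T)) (⟦⟧-map A) (⟦⟧-map B)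
⟦⟧-map (A ⇒ B)  = cong₂ (λ S T → S → T) (⟦⟧-map A) (⟦⟧-map B)

module _ {ATM : Set} where
  open Logic ATM

  module Soundness (M : RationalModel) where
    open RationalModel M renaming (_<_ to _⊏_)

    -- Truth at worlds

    ⌜⌝⁺ : ∀ {w} A → w ⊨ᵖ A → w ⊨ ⌜ A ⌝
    ⌜⌝⁺ A = subst (λ S → S) (sym (⟦⟧-map A))

    ⌜⌝⁻ : ∀ {w} A → w ⊨ ⌜ A ⌝ → w ⊨ᵖ A
    ⌜⌝⁻ A = subst (λ S → S) (⟦⟧-map A)

    minimal⇒□¬ : ∀ {A w} → w ∈ Min A → w ⊨ atom (□¬ A)
    minimal⇒□¬ (_ , below) = return below

    □¬⇒¬ : ∀ {A v w} → v ⊏ w → w ⊨ atom (□¬ A) → v ⊨ ~ ⌜ A ⌝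
    □¬⇒¬ {A} v⊏w □ a = □ λ below → below _ v⊏w (⌜⌝⁻ A a)

    □¬-inherited : ∀ {A v w} → v ⊏ w → w ⊨ atom (□¬ A) → v ⊨ atom (□¬ A)
    □¬-inherited v⊏w □ = □ >>= λ below → return λ u u⊏v → below u (transitive u⊏v v⊏w)

    -- Smoothness turns a smaller world satisfying A into a minimal one.
    diamond-minimal : ∀ {A w} → w ⊨ ~ atom (□¬ A) → ¬ ¬ (∃[ v ] v ⊏ w × v ∈ Min A)
    diamond-minimal {A} ◇ none = ◇ $ return λ v v⊏w a → smooth A v a
      [ (λ min → none (v , v⊏w , min))
      , (λ (u , min , u⊏v) → none (u , transitive u⊏v v⊏w , min)) ]′

    counterexample : ∀ {A B w} → w ⊨ ~ atom (A |~ B) →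
                     ¬ ¬ (∃[ v ] v ∈ Min A × ¬ (v ⊨ᵖ B))
    counterexample {B = B} h none =
      h $ return λ v min → ⟦⟧-stable B λ ¬b → none (v , min , ¬b)

    -- Interpretations of labels

    Interpretation : Set
    Interpretation = Label → W

    infix 4 _⊩_

    -- All formulas of the node are true; the lists of used labels are ignored.
    record _⊩_ (I : Interpretation) (N : Node) : Set where
      constructor all-hold
      field holds : ∀ {α L} → (α ^ L) ∈ N → Holds M I α

    open _⊩_

    -- Satisfied in the fixed model M, by an interpretation of the node's own.
    Satisfied : Node → Set
    Satisfied N = ∃[ I ] I ⊩ N

    infixl 5 _⊩▸_ _⊩∪_

    _⊩▸_ : ∀ {I N α L} → I ⊩ N → Holds M I α → I ⊩ (N ▸ᵃ (α ^ L))
    (s ⊩▸ h) .holds (inj₁ m)    = s .holds m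
    (s ⊩▸ h) .holds (inj₂ refl) = h

    _⊩∪_ : ∀ {I N N′} → I ⊩ N → I ⊩ N′ → I ⊩ (N ∪ N′)
    (s ⊩∪ t) .holds (inj₁ m) = s .holds m
    (s ⊩∪ t) .holds (inj₂ m) = t .holds m

    context : ∀ {I Γ φ} → I ⊩ (Γ ▸ᵃ φ) → I ⊩ Γ
    context s .holds m = s .holds (inj₁ m)

    principal : ∀ {I Γ α L} → I ⊩ (Γ ▸ᵃ (α ^ L)) → Holds M I α
    principal s = s .holds (inj₂ refl)

    transfer-sound : ∀ {I Γ x y} → I ⊩ Γ → I y ⊏ I x → I ⊩ Transfer Γ x y
    transfer-sound s y⊏x .holds (negation m) = □¬⇒¬ y⊏x (s .holds m)
    transfer-sound s y⊏x .holds (box m)      = □¬-inherited y⊏x (s .holds m)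

    axiom-unsatisfied : ∀ {N} → Axiom N → ¬ Satisfied N
    axiom-unsatisfied (clash x P p q) (I , s) = s .holds q (s .holds p)
    axiom-unsatisfied (cycle x y p q) (I , s) =
      irreflexive refl (transitive (s .holds p) (s .holds q))

    -- I with the world of x changed to w.
    _[_↦_] : Interpretation → Label → W → Interpretation
    (I [ x ↦ w ]) y with y ≟ x
    ... | yes _ = w
    ... | no  _ = I y

    update-at : ∀ I x w → (I [ x ↦ w ]) x ≡ w
    update-at I x w with x ≟ x
    ... | yes _   = refl
    ... | no  x≢x = contradiction refl x≢x

    update-other : ∀ I x w {y} → y ≢ x → (I [ x ↦ w ]) y ≡ I y
    update-other I x w {y} y≢x with y ≟ x
    ... | yes y≡x = contradiction y≡x y≢x
    ... | no  _   = refl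

    holds-local : ∀ {I J} α → (∀ {y} → Mentions y α → J y ≡ I y) →
                  Holds M I α → Holds M J α
    holds-local (x ∶ F) J≗I = subst (_⊨ F) (sym (J≗I world))
    holds-local (x ≺ y) J≗I = subst₂ _⊏_ (sym (J≗I left)) (sym (J≗I right))

    occurs⇒≢new : ∀ N {x y α L} → New x N → (α ^ L) ∈ N → Mentions y α → y ≢ x
    occurs⇒≢new _ new m y∈α refl = new (_ , _ , m , y∈α)

    reinterpret : ∀ {I N x} w → New x N → I ⊩ N → (I [ x ↦ w ]) ⊩ N
    reinterpret {I} {N} {x} w new s .holds {α} m =
      holds-local α (λ y∈α → update-other I x w (occurs⇒≢new N new m y∈α)) (s .holds m)

    -- Soundness of the rules

    -- In the cases that assume none, a conclusion that adds a negation ~ F is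
    -- satisfied by assuming F true and then satisfying one of the later
    -- conclusions, or contradicting the principal formula, with its help.
    rule-sound : ∀ {Γ φ Δs} → Γ , φ ⤳ Δs → Satisfied (Γ ▸ᵃ φ) → ¬ ¬ Anyˡ Satisfied Δs
    rule-sound (¬¬ᵣ {F = F}) (I , s) =
      return (here (I , context s ⊩▸ ⟦⟧-stable F (principal s)))
    rule-sound ∧⁺ (I , s) =
      let f , g = principal s in
      return (here (I , context s ⊩▸ f ⊩▸ g))
    rule-sound ∧⁻ (I , s) none =
      none $ here $ I , context s ⊩▸ λ f →
      none $ there $ here $ I , context s ⊩▸ λ g →
      principal s (f , g)
    rule-sound ∨⁺ (I , s) = principal s >>= λ where
      (inj₁ f) → return (here (I , context s ⊩▸ f))
      (inj₂ g) → return (there (here (I , context s ⊩▸ g)))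
    rule-sound ∨⁻ (I , s) =
      return (here (I , context s ⊩▸ (λ f → principal s (return (inj₁ f)))
                                 ⊩▸ (λ g → principal s (return (inj₂ g)))))
    rule-sound ⇒⁺ (I , s) none =
      none $ here $ I , context s ⊩▸ λ f →
      none $ there $ here $ I , context s ⊩▸ principal s f
    rule-sound (⇒⁻ {F = F}) (I , s) =
      return (here (I , context s
        ⊩▸ ⟦⟧-stable F (λ ¬f → principal s λ f → contradiction f ¬f)
        ⊩▸ (λ g → principal s λ _ → g)))
    rule-sound (|~⁺ {A = A} {B} x _ _) (I , s) none =
      -- A world where A and □¬A are both true is minimal for A.
      none $ here $ I , context s ⊩▸ (λ a →
        none $ there $ here $ I , context s ⊩▸ (λ □ →
          principal s λ A|~B → □ λ below →
          none $ there $ there $ here $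
            I , context s ⊩▸ ⌜⌝⁺ B (A|~B (I x) (⌜⌝⁻ A a , below)) ⊩▸ principal s)
        ⊩▸ principal s)
      ⊩▸ principal s
    rule-sound (|~⁻ {u} {A} {B} x new) (I , s) =
      counterexample {A} {B} {I u} (principal s) >>= λ (w , min , ¬b) →
      let x↦w = sym (update-at I x w)
          minₓ = subst (_∈ Min A) x↦w min
      in return (here (I [ x ↦ w ] , context (reinterpret w new s)
           ⊩▸ ⌜⌝⁺ A (proj₁ minₓ)
           ⊩▸ minimal⇒□¬ minₓ
           ⊩▸ subst (λ v → ¬ (v ⊨ᵖ B)) x↦w ¬b ∘ ⌜⌝⁻ B))
    rule-sound {Γ} (□⁻ {x} {A} y new) (I , s) =
      diamond-minimal (principal s) >>= λ (w , w⊏x , min) →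
      let y↦w  = sym (update-at I y w)
          x≢y  = occurs⇒≢new (Γ ▸ x ∶ ~ atom (□¬ A)) new (inj₂ refl) world
          x↦   = sym (update-other I y w x≢y)
          y⊏x  = subst₂ _⊏_ y↦w x↦ w⊏x
          minᵧ = subst (_∈ Min A) y↦w min
          t    = context (reinterpret w new s)
      in return (here (I [ y ↦ w ] , (t ⊩▸ y⊏x ⊩∪ transfer-sound t y⊏x)
           ⊩▸ ⌜⌝⁺ A (proj₁ minᵧ)
           ⊩▸ minimal⇒□¬ minᵧ))
    rule-sound (<ᵣ z _ _ _) (I , s) = modular (I z) _ _ (principal s) >>= λ where
      (inj₁ x⊏z) → return (there (here (I , (s ⊩▸ x⊏z) ⊩∪ transfer-sound (context s) x⊏z)))
      (inj₂ z⊏y) → return (here (I , (s ⊩▸ z⊏y) ⊩∪ transfer-sound (context s) z⊏y))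

    step-sound : ∀ {N Δs} → N ⟶ Δs → Satisfied N → ¬ ¬ Anyˡ Satisfied Δs
    step-sound (apply (_ , Γφ⊆N) r) (I , s) = rule-sound r (I , all-hold (s .holds ∘ Γφ⊆N))

    -- The leftmost satisfied branch

    -- An absent node is not satisfied.  Elimination into Set keeps this a small
    -- type, as membership of a branch must be.
    Satisfiedᵐ : Maybe Node → Set
    Satisfiedᵐ = maybe′ Satisfied ⊥

    satisfied⇒present : ∀ {m} → Satisfiedᵐ m → Is-just m
    satisfied⇒present {just _} _ = Maybe.just tt

    satisfied-child : ∀ {Δs} → Anyˡ Satisfied Δs → ∃[ i ] Satisfiedᵐ (head (drop i Δs))
    satisfied-child (here s)  = 0 , s
    satisfied-child (there p) = let i , s = satisfied-child p in ℕ.suc i , s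

    -- A node with a child is not a leaf, so a rule was applied to it.
    local-sound : ∀ {m c i} → Local m c → Is-just (c i) → Satisfiedᵐ m →
                  ¬ ¬ (∃[ j ] Satisfiedᵐ (c j))
    local-sound {c = c} {i} (leaf none) present _ with c i | none i | present
    ... | _ | refl | ()
    local-sound (expanded step children) _ s =
      step-sound step s >>= λ p →
      let j , t = satisfied-child p in
      return (j , subst Satisfiedᵐ (sym (children j)) t)

    module _ {N : Node} (T : Tableau N) where
      open Tableau T

      -- The addresses of the root and, recursively, of the first satisfied child of
      -- each node already reached.
      Leftmost : Pred Address 0ℓ
      Leftmost []      = ⊤
      Leftmost (i ∷ p) = Leftmost p × Least (λ j → Satisfiedᵐ (at (j ∷ p))) i

      module _ (s : Satisfied N) where

        leftmost-satisfied : ∀ p → Leftmost p → Satisfiedᵐ (at p)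
        leftmost-satisfied []      _           = subst Satisfiedᵐ (sym root) s
        leftmost-satisfied (i ∷ p) (_ , t , _) = t

        leftmost-branch : Branch T
        leftmost-branch = record
          { On      = Leftmost
          ; present = λ {p} on → satisfied⇒present (leftmost-satisfied p on)
          ; start   = tt
          ; parent  = proj₁
          ; linear  = λ (_ , li) (_ , lj) → least-unique li lj
          ; maximal = λ {i} {p} on present →
              local-sound {i = i} (local p) present (leftmost-satisfied p on) >>= λ (j , t) →
              ¬¬-least _ j t >>= λ (k , first) →
              return (k , on , first)
          }

        leftmost-open : ¬ ClosedBranch leftmost-branch
        leftmost-open closed = closed λ (p , on , ax) → no-axiom ax (leftmost-satisfied p on)
          where
          no-axiom : ∀ {m} → Maybe.Any Axiom m → ¬ Satisfiedᵐ m
          no-axiom (Maybe.just ax) = axiom-unsatisfied ax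

theorem6p5 : (ATM : Set) → let open Logic ATM in
    (Γ : Pred LabelledFormula 0ℓ) →
    (∃[ T ] ClosedTableau {Initial Γ} T) →
    Unsatisfiable Γ
theorem6p5 ATM Γ (T , closed) (M , I , s) = leftmost-open T sat (closed (leftmost-branch T sat))
  where
  open Logic ATM
  open Soundness M

  sat : Satisfied (Initial Γ)
  sat = I , all-hold λ { (initial α∈Γ) → s α∈Γ }
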